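{- Let $T$ be the monad on $\mathsf{Set}$ generated by an algebraic theory (a signature of operation symbols with finite arities together with a set of equations) none of whose equations is a drop equation. Then the underlying functor of $T$ preserves pullbacks of monomorphisms (in particular it preserves monomorphisms). Consequently, if $\rho$ is an uncountable regular ordinal, then $T$ preserves $\rho^{\mathrm{op}}$-indexed limits, i.e. for every functor $X:\rho^{\mathrm{op}}\to\mathsf{Set}$ the canonical map $T(\lim X) \to \lim T(X)$ is a bijection.
   Context: A signature is a set $\Sigma$ of operation symbols, each with an arity $n \in \mathbb{N}$. For a set $X$, the set $\mathsf{Tm}(X)$ of terms is defined inductively: each $x\in X$ is a term, and if $\mathsf{op}\in\Sigma$ has arity $n$ and $t_1,\dots,t_n \in \mathsf{Tm}(X)$ then $\mathsf{op}(t_1,\dots,t_n) \in \mathsf{Tm}(X)$. An equation is a pair $(t,s)$ of terms in some $\mathsf{Tm}(X)$; an algebraic theory is a signature with a set of equations. The generated monad is $T(X) = \mathsf{Tm}(X)/\sim$, where $\sim$ is the smallest congruence on $\mathsf{Tm}(X)$ containing all substitution instances of the equations; $T$ acts on maps by substituting variables. An equation $(t,s)$ is a drop equation if the sets of free variables of $t$ and $s$ differ. $T$ preserves pullbacks of monomorphisms if it maps every pullback square in $\mathsf{Set}$ one of whose legs is a monomorphism (specifically, pullbacks of an inclusion $Z \subseteq Y$ along any map $f: X\to Y$) to a pullback square. An ordinal $\rho$ is regular if it is a limit ordinal equal to its own cofinality. -}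

-- The category Set is rendered as setoids and setoid maps, since Agda has no
-- quotient types: the quotient Tm(X)/∼ is the setoid with carrier Tm(X) and
-- equality ∼.  A universe level ℓ fixes the size of the sets considered.

module Defs where

open import Level using (Level; suc; _⊔_)
open import Data.Nat.Base using (ℕ)
open import Data.Fin.Base using (Fin)
open import Data.Product.Base using (Σ; Σ-syntax; ∃-syntax; _×_; _,_; proj₁; proj₂)
open import Data.Sum.Base using (inj₂)
open import Function.Base using (flip)
open import Function.Bundles using (Func; _⟶ₛ_; _⟨$⟩_; _⇔_; Injection)
open import Function.Definitions using (Bijective)
open import Induction.WellFounded using (WellFounded)
open import Relation.Binary.Bundles using (Setoid; StrictTotalOrder)
open import Relation.Binary.Core using (Rel)
open import Relation.Nullary.Negation.Core using (¬_)
import Function.Construct.Composition as Composition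
import Function.Construct.Identity as Identity
import Function.Relation.Binary.Setoid.Equality as FuncEquality
import Relation.Binary.Construct.StrictToNonStrict as StrictToNonStrict
import Relation.Binary.PropositionalEquality.Properties as ≡

------------------------------------------------------------------------
-- The category of sets

𝐒𝐞𝐭 : (ℓ : Level) → Set (suc ℓ)
𝐒𝐞𝐭 ℓ = Setoid ℓ ℓ

module _ {ℓ : Level} where

  infix 4 _≗_
  infixr 9 _∘ₛ_

  ∣_∣ : 𝐒𝐞𝐭 ℓ → Set ℓ
  ∣ X ∣ = Setoid.Carrier X

  _≗_ : {X Y : 𝐒𝐞𝐭 ℓ} → Rel (X ⟶ₛ Y) ℓ
  _≗_ {X} {Y} = FuncEquality._≈_ X Y

  idₛ : {X : 𝐒𝐞𝐭 ℓ} → X ⟶ₛ X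
  idₛ {X} = Identity.function X

  _∘ₛ_ : {X Y Z : 𝐒𝐞𝐭 ℓ} → Y ⟶ₛ Z → X ⟶ₛ Y → X ⟶ₛ Z
  _∘ₛ_ = flip Composition.function

  IsMono : {Z Y : 𝐒𝐞𝐭 ℓ} → Z ⟶ₛ Y → Set (suc ℓ)
  IsMono {Z} {Y} m = (W : 𝐒𝐞𝐭 ℓ) (g h : W ⟶ₛ Z) → m ∘ₛ g ≗ m ∘ₛ h → g ≗ h

  -- The square with  p : P → X,  q : P → Z,  f : X → Y,  m : Z → Y.
  record IsPullback {P X Z Y : 𝐒𝐞𝐭 ℓ}
                    (p : P ⟶ₛ X) (q : P ⟶ₛ Z)
                    (f : X ⟶ₛ Y) (m : Z ⟶ₛ Y) : Set (suc ℓ) where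
    field
      commutes : f ∘ₛ p ≗ m ∘ₛ q
      universal : (W : 𝐒𝐞𝐭 ℓ) (a : W ⟶ₛ X) (b : W ⟶ₛ Z) → f ∘ₛ a ≗ m ∘ₛ b →
                  Σ[ u ∈ W ⟶ₛ P ]
                    (p ∘ₛ u ≗ a) × (q ∘ₛ u ≗ b) ×
                    ((v : W ⟶ₛ P) → p ∘ₛ v ≗ a → q ∘ₛ v ≗ b → v ≗ u)

------------------------------------------------------------------------
-- Endofunctors and monads on Set

record Functor (ℓ : Level) : Set (suc ℓ) where
  field
    F₀     : 𝐒𝐞𝐭 ℓ → 𝐒𝐞𝐭 ℓ
    F₁     : {X Y : 𝐒𝐞𝐭 ℓ} → X ⟶ₛ Y → F₀ X ⟶ₛ F₀ Y
    F-cong : {X Y : 𝐒𝐞𝐭 ℓ} (f g : X ⟶ₛ Y) → f ≗ g → F₁ f ≗ F₁ g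
    F-id   : {X : 𝐒𝐞𝐭 ℓ} → F₁ (idₛ {X = X}) ≗ idₛ
    F-∘    : {X Y Z : 𝐒𝐞𝐭 ℓ} (g : Y ⟶ₛ Z) (f : X ⟶ₛ Y) →
             F₁ (g ∘ₛ f) ≗ F₁ g ∘ₛ F₁ f

-- Monads in extension form (Kleisli triples).
record Monad (ℓ : Level) : Set (suc ℓ) where
  field
    T₀        : 𝐒𝐞𝐭 ℓ → 𝐒𝐞𝐭 ℓ
    return    : {X : 𝐒𝐞𝐭 ℓ} → X ⟶ₛ T₀ X
    bind      : {X Y : 𝐒𝐞𝐭 ℓ} → X ⟶ₛ T₀ Y → T₀ X ⟶ₛ T₀ Y
    bind-cong : {X Y : 𝐒𝐞𝐭 ℓ} (f g : X ⟶ₛ T₀ Y) → f ≗ g → bind f ≗ bind g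
    identityˡ : {X Y : 𝐒𝐞𝐭 ℓ} (f : X ⟶ₛ T₀ Y) → bind f ∘ₛ return ≗ f
    identityʳ : {X : 𝐒𝐞𝐭 ℓ} → bind (return {X}) ≗ idₛ
    assoc     : {X Y Z : 𝐒𝐞𝐭 ℓ} (g : Y ⟶ₛ T₀ Z) (f : X ⟶ₛ T₀ Y) →
                bind g ∘ₛ bind f ≗ bind (bind g ∘ₛ f)

  functor : Functor ℓ
  functor = record
    { F₀     = T₀
    ; F₁     = λ f → bind (return ∘ₛ f)
    ; F-cong = λ f g f≗g → bind-cong (return ∘ₛ f) (return ∘ₛ g)
                             (λ x → Func.cong return (f≗g x))
    ; F-id   = identityʳ
    ; F-∘    = λ {X} {Y} {Z} g f t → Setoid.sym (T₀ Z) (Setoid.trans (T₀ Z)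
          (assoc (return ∘ₛ g) (return ∘ₛ f) t)
          (bind-cong (bind (return ∘ₛ g) ∘ₛ (return ∘ₛ f)) (return ∘ₛ (g ∘ₛ f))
            (λ x → identityˡ (return ∘ₛ g) (f ⟨$⟩ x)) t))
    }

module _ {ℓ : Level} (F : Functor ℓ) where
  open Functor F

  PreservesMonos : Set (suc ℓ)
  PreservesMonos = {Z Y : 𝐒𝐞𝐭 ℓ} (m : Z ⟶ₛ Y) → IsMono m → IsMono (F₁ m)

  PreservesPullbacksOfMonos : Set (suc ℓ)
  PreservesPullbacksOfMonos =
    {P X Z Y : 𝐒𝐞𝐭 ℓ}
    (p : P ⟶ₛ X) (q : P ⟶ₛ Z) (f : X ⟶ₛ Y) (m : Z ⟶ₛ Y) →
    IsMono m → IsPullback p q f m → IsPullback (F₁ p) (F₁ q) (F₁ f) (F₁ m)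

------------------------------------------------------------------------
-- Algebraic theories

record Signature (ℓ : Level) : Set (suc ℓ) where
  field
    Op    : Set ℓ
    arity : Op → ℕ

module _ {ℓ : Level} (Sg : Signature ℓ) where
  open Signature Sg

  data Tm (X : Set ℓ) : Set ℓ where
    var : X → Tm X
    op  : (o : Op) → (Fin (arity o) → Tm X) → Tm X

module _ {ℓ : Level} {Sg : Signature ℓ} where
  open Signature Sg

  infix 4 _∈fv_
  infixl 10 _[_]

  data _∈fv_ {X : Set ℓ} (x : X) : Tm Sg X → Set ℓ where
    here  : x ∈fv var x
    there : {o : Op} {ts : Fin (arity o) → Tm Sg X} (i : Fin (arity o)) →
            x ∈fv ts i → x ∈fv op o ts

  _[_] : {X Y : Set ℓ} → Tm Sg X → (X → Tm Sg Y) → Tm Sg Y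
  var x   [ σ ] = σ x
  op o ts [ σ ] = op o (λ i → ts i [ σ ])

record Equation {ℓ : Level} (Sg : Signature ℓ) : Set (suc ℓ) where
  field
    Var : Set ℓ
    lhs : Tm Sg Var
    rhs : Tm Sg Var

IsDrop : {ℓ : Level} {Sg : Signature ℓ} → Equation Sg → Set ℓ
IsDrop E = ¬ ((x : Var) → (x ∈fv lhs) ⇔ (x ∈fv rhs))
  where
  open Equation E

record Theory (ℓ : Level) : Set (suc ℓ) where
  field
    signature : Signature ℓ
    Axiom     : Set ℓ
    equation  : Axiom → Equation signature

  Term : Set ℓ → Set ℓ
  Term = Tm signature

  open Signature signature public
  module Eqn (a : Axiom) = Equation (equation a)

NoDropEquations : {ℓ : Level} → Theory ℓ → Set ℓ
NoDropEquations 𝕋 = (a : Axiom) → ¬ IsDrop (equation a)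
  where
  open Theory 𝕋

------------------------------------------------------------------------
-- The generated monad

module Generated {ℓ : Level} (𝕋 : Theory ℓ) where
  open Theory 𝕋

  infix 4 _⊢_∼_

  -- The constructor ≈-var identifies variables that are equal elements of
  -- the setoid X; the others generate the smallest congruence containing all
  -- substitution instances of the equations.
  data _⊢_∼_ (X : 𝐒𝐞𝐭 ℓ) : Rel (Term ∣ X ∣) ℓ where
    ≈-var    : {x y : ∣ X ∣} → Setoid._≈_ X x y → X ⊢ var x ∼ var y
    axiom    : (a : Axiom) (σ : Eqn.Var a → Term ∣ X ∣) →
               X ⊢ Eqn.lhs a [ σ ] ∼ Eqn.rhs a [ σ ]
    op-cong  : {o : Op} {ts ss : Fin (arity o) → Term ∣ X ∣} →
               ((i : Fin (arity o)) → X ⊢ ts i ∼ ss i) → X ⊢ op o ts ∼ op o ss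
    ∼-refl   : {t : Term ∣ X ∣} → X ⊢ t ∼ t
    ∼-sym    : {t s : Term ∣ X ∣} → X ⊢ t ∼ s → X ⊢ s ∼ t
    ∼-trans  : {t s r : Term ∣ X ∣} → X ⊢ t ∼ s → X ⊢ s ∼ r → X ⊢ t ∼ r

  T : 𝐒𝐞𝐭 ℓ → 𝐒𝐞𝐭 ℓ
  T X = record
    { Carrier       = Term ∣ X ∣
    ; _≈_           = X ⊢_∼_
    ; isEquivalence = record { refl = ∼-refl ; sym = ∼-sym ; trans = ∼-trans }
    }

  []-assoc : (Z : 𝐒𝐞𝐭 ℓ) {X Y : Set ℓ} (t : Term X)
             (σ : X → Term Y) (τ : Y → Term ∣ Z ∣) →
             Z ⊢ t [ σ ] [ τ ] ∼ t [ (λ x → σ x [ τ ]) ]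
  []-assoc Z (var x)   σ τ = ∼-refl
  []-assoc Z (op o ts) σ τ = op-cong (λ i → []-assoc Z (ts i) σ τ)

  []-congʳ : (Y : 𝐒𝐞𝐭 ℓ) {X : Set ℓ} (t : Term X) {σ τ : X → Term ∣ Y ∣} →
             ((x : X) → Y ⊢ σ x ∼ τ x) → Y ⊢ t [ σ ] ∼ t [ τ ]
  []-congʳ Y (var x)   eq = eq x
  []-congʳ Y (op o ts) eq = op-cong (λ i → []-congʳ Y (ts i) eq)

  []-identity : (X : 𝐒𝐞𝐭 ℓ) (t : Term ∣ X ∣) → X ⊢ t [ var ] ∼ t
  []-identity X (var x)   = ∼-refl
  []-identity X (op o ts) = op-cong (λ i → []-identity X (ts i))

  []-congˡ : {X Y : 𝐒𝐞𝐭 ℓ} (f : X ⟶ₛ T Y) {t s : Term ∣ X ∣} →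
             X ⊢ t ∼ s → Y ⊢ t [ f ⟨$⟩_ ] ∼ s [ f ⟨$⟩_ ]
  []-congˡ f (≈-var x≈y)   = Func.cong f x≈y
  []-congˡ {Y = Y} f (axiom a σ)   =
    ∼-trans ([]-assoc Y (Eqn.lhs a) σ (f ⟨$⟩_))
      (∼-trans (axiom a (λ x → σ x [ f ⟨$⟩_ ]))
        (∼-sym ([]-assoc Y (Eqn.rhs a) σ (f ⟨$⟩_))))
  []-congˡ f (op-cong eqs) = op-cong (λ i → []-congˡ f (eqs i))
  []-congˡ f ∼-refl        = ∼-refl
  []-congˡ f (∼-sym p)     = ∼-sym ([]-congˡ f p)
  []-congˡ f (∼-trans p q) = ∼-trans ([]-congˡ f p) ([]-congˡ f q)

  monad : Monad ℓ
  monad = record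
    { T₀        = T
    ; return    = record { to = var ; cong = ≈-var }
    ; bind      = λ f → record { to = _[ f ⟨$⟩_ ] ; cong = []-congˡ f }
    ; bind-cong = λ {_} {Y} f g f≗g t → []-congʳ Y t f≗g
    ; identityˡ = λ f x → ∼-refl
    ; identityʳ = λ {X} → []-identity X
    ; assoc     = λ {_} {_} {Z} g f t → []-assoc Z t (f ⟨$⟩_) (g ⟨$⟩_)
    }

open Generated public using () renaming (monad to generatedMonad)

------------------------------------------------------------------------
-- Ordinals, as well-ordered sets; equality of ordinals is isomorphism

record Ordinal (ℓ : Level) : Set (suc ℓ) where
  field
    order : StrictTotalOrder ℓ ℓ ℓ
  open StrictTotalOrder order public using (_≈_; _<_; module Eq)
  field
    wellFounded : WellFounded _<_

  underlying : 𝐒𝐞𝐭 ℓ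
  underlying = StrictTotalOrder.Eq.setoid order

  open StrictToNonStrict _≈_ _<_ public using (_≤_)

  ≤-refl : {α : ∣ underlying ∣} → α ≤ α
  ≤-refl = inj₂ Eq.refl

  ≤-trans : {α β γ : ∣ underlying ∣} → α ≤ β → β ≤ γ → α ≤ γ
  ≤-trans = StrictToNonStrict.trans _≈_ _<_ Eq.isEquivalence
              (StrictTotalOrder.<-resp-≈ order) (StrictTotalOrder.trans order)

module _ {ℓ : Level} where
  open Ordinal

  StrictlyIncreasing : (κ ρ : Ordinal ℓ) → underlying κ ⟶ₛ underlying ρ → Set ℓ
  StrictlyIncreasing κ ρ f =
    {α β : ∣ underlying κ ∣} → _<_ κ α β → _<_ ρ (f ⟨$⟩ α) (f ⟨$⟩ β)

  -- κ ≼ ρ: the ordinal κ is isomorphic to an initial segment of ρ.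
  record _≼_ (κ ρ : Ordinal ℓ) : Set ℓ where
    field
      embed      : underlying κ ⟶ₛ underlying ρ
      increasing : StrictlyIncreasing κ ρ embed
      initial    : (α : ∣ underlying κ ∣) (β : ∣ underlying ρ ∣) →
                   _<_ ρ β (embed ⟨$⟩ α) →
                   ∃[ γ ] _<_ κ γ α × _≈_ ρ (embed ⟨$⟩ γ) β

  -- Some cofinal subset of ρ has order type κ; the subset is given by its
  -- increasing enumeration.
  record CofinalSubsetOfType (ρ κ : Ordinal ℓ) : Set ℓ where
    field
      enum       : underlying κ ⟶ₛ underlying ρ
      increasing : StrictlyIncreasing κ ρ enum
      cofinal    : (α : ∣ underlying ρ ∣) → ∃[ β ] _≤_ ρ α (enum ⟨$⟩ β)

  -- κ is the least order type of a cofinal subset of ρ.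
  record IsCofinalityOf (ρ κ : Ordinal ℓ) : Set (suc ℓ) where
    field
      attained : CofinalSubsetOfType ρ κ
      least    : (δ : Ordinal ℓ) → CofinalSubsetOfType ρ δ → κ ≼ δ

  record IsLimitOrdinal (ρ : Ordinal ℓ) : Set ℓ where
    field
      nonZero      : ∣ underlying ρ ∣
      notSuccessor : (α : ∣ underlying ρ ∣) → ∃[ β ] _<_ ρ α β

  IsRegular : Ordinal ℓ → Set (suc ℓ)
  IsRegular ρ = IsLimitOrdinal ρ × IsCofinalityOf ρ ρ

  IsUncountable : Ordinal ℓ → Set ℓ
  IsUncountable ρ = ¬ Injection (underlying ρ) (≡.setoid ℕ)

------------------------------------------------------------------------
-- ρᵒᵖ-indexed limits

-- Functors ρᵒᵖ → Set, where ρ is the category of its elements ordered by ≤.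
record Diagram {ℓ : Level} (ρ : Ordinal ℓ) : Set (suc ℓ) where
  open Ordinal ρ
  field
    X₀     : ∣ underlying ∣ → 𝐒𝐞𝐭 ℓ
    X₁     : {α β : ∣ underlying ∣} → α ≤ β → X₀ β ⟶ₛ X₀ α
    -- hom-sets of ρ have at most one element
    X-cong : {α β : ∣ underlying ∣} (p q : α ≤ β) → X₁ p ≗ X₁ q
    X-id   : {α : ∣ underlying ∣} → X₁ (≤-refl {α}) ≗ idₛ
    X-∘    : {α β γ : ∣ underlying ∣} (p : α ≤ β) (q : β ≤ γ) →
             X₁ (≤-trans p q) ≗ X₁ p ∘ₛ X₁ q

module _ {ℓ : Level} {ρ : Ordinal ℓ} where
  open Ordinal ρ

  infixr 9 _∘ᴰ_

  _∘ᴰ_ : Functor ℓ → Diagram ρ → Diagram ρ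
  F ∘ᴰ X = record
    { X₀     = λ α → F₀ (X₀ α)
    ; X₁     = λ p → F₁ (X₁ p)
    ; X-cong = λ p q → F-cong (X₁ p) (X₁ q) (X-cong p q)
    ; X-id   = λ {α} t → Setoid.trans (F₀ (X₀ α))
                 (F-cong (X₁ ≤-refl) idₛ X-id t) (F-id t)
    ; X-∘    = λ {α} p q t → Setoid.trans (F₀ (X₀ α))
                 (F-cong (X₁ (≤-trans p q)) (X₁ p ∘ₛ X₁ q) (X-∘ p q) t)
                 (F-∘ (X₁ p) (X₁ q) t)
    }
    where
    open Functor F
    open Diagram X

  module _ (X : Diagram ρ) where
    open Diagram X

    Compatible : ((α : ∣ underlying ∣) → ∣ X₀ α ∣) → Set ℓ
    Compatible x = {α β : ∣ underlying ∣} (p : α ≤ β) →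
                   Setoid._≈_ (X₀ α) (X₁ p ⟨$⟩ x β) (x α)

    lim : 𝐒𝐞𝐭 ℓ
    lim = record
      { Carrier       = Σ ((α : ∣ underlying ∣) → ∣ X₀ α ∣) Compatible
      ; _≈_           = λ x y → (α : ∣ underlying ∣) →
                          Setoid._≈_ (X₀ α) (proj₁ x α) (proj₁ y α)
      ; isEquivalence = record
        { refl  = λ α → Setoid.refl (X₀ α)
        ; sym   = λ x≈y α → Setoid.sym (X₀ α) (x≈y α)
        ; trans = λ x≈y y≈z α → Setoid.trans (X₀ α) (x≈y α) (y≈z α)
        }
      }

    π : (α : ∣ underlying ∣) → lim ⟶ₛ X₀ α
    π α = record { to = λ x → proj₁ x α ; cong = λ x≈y → x≈y α }

  canonical : (F : Functor ℓ) (X : Diagram ρ) → Functor.F₀ F (lim X) ⟶ₛ lim (F ∘ᴰ X)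
  canonical F X = record
    { to   = λ t → (λ α → F₁ (π X α) ⟨$⟩ t)
                 , (λ {α} {β} p → Setoid.trans (F₀ (X₀ α))
                     (Setoid.sym (F₀ (X₀ α)) (F-∘ (X₁ p) (π X β) t))
                     (F-cong (X₁ p ∘ₛ π X β) (π X α) (λ x → proj₂ x p) t))
    ; cong = λ t≈s α → Func.cong (F₁ (π X α)) t≈s
    }
    where
    open Functor F
    open Diagram X

PreservesOpLimits : {ℓ : Level} → Functor ℓ → Ordinal ℓ → Set (suc ℓ)
PreservesOpLimits F ρ =
  (X : Diagram ρ) →
  Bijective (Setoid._≈_ (Functor.F₀ F (lim X))) (Setoid._≈_ (lim (F ∘ᴰ X)))
            (canonical F X ⟨$⟩_)

{-# OPTIONS --safe #-}
-- Without drop equations, the set of variables of a term is an invariant of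
-- its ∼-class.  A map g that is injective on the variables of t and s has a
-- Kleisli retraction there (send a point outside the image to any fixed term),
-- so T g separates t and s; this gives preservation of monos, and together with
-- invariance of variables preservation of their pullbacks.
--
-- For limits, a compatible family t α ∈ T (X α) has finite variable sets S α,
-- and the transition maps restrict to surjections S β → S α.  If for every α
-- some later surjection S β → S α were not injective, there would be an
-- increasing ω-sequence of such indices αₙ.  As ρ is regular and
-- uncountable, the sequence has an upper bound γ, and the kernels of
-- S γ → S (αₙ) would strictly decrease forever although S γ is finite.  Hence
-- the S α are eventually constant, and their elements extend to threads.
module Submission where

open import Defs
open import Level using (Level; Lift; lift; lower)
open import Axiom.ExcludedMiddle using (ExcludedMiddle)
open import Data.Empty using (⊥-elim)
open import Data.Fin.Base as Fin using (Fin)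
open import Data.Nat.Base as ℕ using (ℕ)
open import Data.Nat.Induction using (<-wellFounded)
import Data.Nat.Properties as ℕ
open import Data.Product.Base using (Σ-syntax; ∃-syntax; _×_; _,_; proj₁; proj₂)
open import Data.Sum.Base using (_⊎_; inj₁; inj₂)
open import Data.Unit.Polymorphic.Base using (⊤; tt)
open import Function.Base using (_∘_)
open import Function.Bundles using (Func; _⟶ₛ_; _⟨$⟩_; _⇔_; Equivalence)
open import Function.Definitions using (Bijective; Injective)
import Function.Construct.Constant as Constant
open import Induction.WellFounded using (module Subrelation)
import Relation.Binary.Construct.On as On
open import Relation.Binary.Bundles using (Setoid; StrictTotalOrder)
open import Relation.Binary.Core using (Rel)
open import Relation.Binary.Definitions using (tri<; tri≈; tri>)
open import Relation.Binary.PropositionalEquality.Core using (_≡_; refl; sym; trans)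
import Relation.Binary.PropositionalEquality.Properties as ≡
open import Relation.Nullary.Decidable.Core using (Dec; yes; no)
open import Relation.Nullary.Negation.Core using (¬_)

private
  variable
    ℓ : Level

-- Points and monomorphisms of setoids

𝟙 : 𝐒𝐞𝐭 ℓ
𝟙 = ≡.setoid ⊤

point : (X : 𝐒𝐞𝐭 ℓ) → ∣ X ∣ → 𝟙 ⟶ₛ X
point X = Constant.function 𝟙 X

module _ {X Y : 𝐒𝐞𝐭 ℓ} where
  private
    module X = Setoid X
    module Y = Setoid Y

  mono⇒injective : (m : X ⟶ₛ Y) → IsMono m → Injective X._≈_ Y._≈_ (m ⟨$⟩_)
  mono⇒injective m mono {x} {y} mx≈my =
    mono 𝟙 (point X x) (point X y) (λ _ → mx≈my) tt

  injective⇒mono : (m : X ⟶ₛ Y) → Injective X._≈_ Y._≈_ (m ⟨$⟩_) → IsMono m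
  injective⇒mono m inj W g h mg≗mh w = inj (mg≗mh w)

module _ {P X Z Y : 𝐒𝐞𝐭 ℓ} {p : P ⟶ₛ X} {q : P ⟶ₛ Z} {f : X ⟶ₛ Y} {m : Z ⟶ₛ Y}
         (pb : IsPullback p q f m) where
  open IsPullback pb
  private
    module P = Setoid P
    module X = Setoid X
    module Y = Setoid Y
    module Z = Setoid Z

  pullback-point : (x : ∣ X ∣) (z : ∣ Z ∣) → (f ⟨$⟩ x) Y.≈ (m ⟨$⟩ z) →
                   ∃[ u ] (p ⟨$⟩ u) X.≈ x
  pullback-point x z fx≈mz =
    let (u , pu≗x , _) = universal 𝟙 (point X x) (point Z z) (λ _ → fx≈mz)
    in u ⟨$⟩ tt , pu≗x tt

  -- Two points of `P` over the same point of `X` also agree in `Z`, as `m` is injective; both are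
  -- then the unique mediating point of one cone.
  pullback-injective : IsMono m → Injective P._≈_ X._≈_ (p ⟨$⟩_)
  pullback-injective mono {u} {v} pu≈pv =
    let qu≈qv = mono⇒injective m mono
                  (Y.trans (Y.sym (commutes u)) (Y.trans (Func.cong f pu≈pv) (commutes v)))
        (w , _ , _ , unique) = universal 𝟙 (point X (p ⟨$⟩ v)) (point Z (q ⟨$⟩ v))
                                 (λ _ → commutes v)
    in P.trans (unique (point P u) (λ _ → pu≈pv) (λ _ → qu≈qv) tt)
         (P.sym (unique (point P v) (λ _ → X.refl) (λ _ → Z.refl) tt))

-- Variables of terms

module _ {Sg : Signature ℓ} where

  ∈fv-[]⁺ : {X Y : Set ℓ} {σ : X → Tm Sg Y} {t : Tm Sg X} {x : X} {y : Y} →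
            x ∈fv t → y ∈fv σ x → y ∈fv t [ σ ]
  ∈fv-[]⁺ here        y∈ = y∈
  ∈fv-[]⁺ (there i x∈) y∈ = there i (∈fv-[]⁺ x∈ y∈)

  ∈fv-[]⁻ : {X Y : Set ℓ} {σ : X → Tm Sg Y} (t : Tm Sg X) {y : Y} →
            y ∈fv t [ σ ] → ∃[ x ] (x ∈fv t × y ∈fv σ x)
  ∈fv-[]⁻ (var x)   y∈ = x , here , y∈
  ∈fv-[]⁻ (op o ts) (there i y∈) =
    let (x , x∈ , y∈σx) = ∈fv-[]⁻ (ts i) y∈ in x , there i x∈ , y∈σx

-- Uniform indices for finitely many conditions

module _ {I : Set ℓ} {_≲_ : Rel I ℓ}
         (directed : ∀ i j → ∃[ k ] (i ≲ k × j ≲ k)) (i₀ : I) where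

  Fin-uniform : ∀ n (Q : Fin n → I → Set ℓ) →
                (∀ a {i j} → i ≲ j → Q a i → Q a j) →
                (∀ a → ∃[ i ] Q a i) → ∃[ i ] (∀ a → Q a i)
  Fin-uniform ℕ.zero    Q mono ex = i₀ , λ ()
  Fin-uniform (ℕ.suc n) Q mono ex =
    let (i , q₀) = ex Fin.zero
        (j , qs) = Fin-uniform n (Q ∘ Fin.suc) (mono ∘ Fin.suc) (ex ∘ Fin.suc)
        (k , i≲k , j≲k) = directed i j
    in k , λ { Fin.zero    → mono Fin.zero i≲k q₀
             ; (Fin.suc a) → mono (Fin.suc a) j≲k (qs a) }

  -- Recursion on the term uses the finiteness of its variable set without listing the variables;
  -- `mono` lets all subterms share one index.
  fv-uniform : {Sg : Signature ℓ} {X : Set ℓ} (t : Tm Sg X) (Q : X → I → Set ℓ) →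
               (∀ x {i j} → i ≲ j → Q x i → Q x j) →
               (∀ x → ∃[ i ] Q x i) → ∃[ i ] (∀ {x} → x ∈fv t → Q x i)
  fv-uniform (var x) Q mono ex = let (i , q) = ex x in i , λ { here → q }
  fv-uniform {Sg} {X} (op o ts) Q mono ex =
    let (i , q) = Fin-uniform _ (λ a i → ∀ {x} → x ∈fv ts a → Q x i)
                    (λ a i≲j q x∈ → mono _ i≲j (q x∈))
                    (λ a → fv-uniform (ts a) Q mono ex)
    in i , λ { (there a x∈) → q a x∈ }

  -- A decreasing family of relations is eventually constant on the finitely
  -- many pairs of variables.
  fv-kernels-stabilise :
    ExcludedMiddle ℓ →
    {Sg : Signature ℓ} {X : Set ℓ} (K : I → Rel X ℓ) →
    (∀ {i j} → i ≲ j → ∀ {x y} → K j x y → K i x y) →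
    (t s : Tm Sg X) →
    ∃[ i ] (∀ {x y} → x ∈fv t → y ∈fv s → K i x y → ∀ j → K j x y)
  fv-kernels-stabilise em {Sg} {X} K anti t s =
    let (i , q) = fv-uniform t (λ x i → ∀ {y} → y ∈fv s → Stable x y i)
                    (λ x i≲j q y∈ → Stable-mono i≲j (q y∈))
                    (λ x → fv-uniform s (Stable x) (λ y → Stable-mono) (stable x))
    in i , λ x∈ y∈ → q x∈ y∈
    where
    Stable : X → X → I → Set ℓ
    Stable x y i = K i x y → ∀ j → K j x y

    Stable-mono : ∀ {x y i j} → i ≲ j → Stable x y i → Stable x y j
    Stable-mono i≲j q k = q (anti i≲j k)

    -- If `K` fails for this pair at some index, the implication is vacuous there; otherwise its
    -- conclusion always holds.
    stable : ∀ x y → ∃[ i ] Stable x y i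
    stable x y with em {∃[ i ] ¬ K i x y}
    ... | yes (i , ¬k) = i , λ k → ⊥-elim (¬k k)
    ... | no  none     = i₀ , λ _ j → decide j
      where
      decide : ∀ j → K j x y
      decide j with em {K j x y}
      ... | yes k = k
      ... | no ¬k = ⊥-elim (none (j , ¬k))

-- The functor of a theory

module TheoryFunctor (em : ExcludedMiddle ℓ) (𝕋 : Theory ℓ) where
  open Theory 𝕋
  open Generated 𝕋
  open Functor (Monad.functor (generatedMonad 𝕋)) public

  []-cong-fv : (Y : 𝐒𝐞𝐭 ℓ) {X : Set ℓ} (t : Term X) {σ τ : X → Term ∣ Y ∣} →
               (∀ {x} → x ∈fv t → Y ⊢ σ x ∼ τ x) → Y ⊢ t [ σ ] ∼ t [ τ ]
  []-cong-fv Y (var x)   eq = eq here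
  []-cong-fv Y (op o ts) eq = op-cong (λ i → []-cong-fv Y (ts i) (eq ∘ there i))

  module _ {X Y : 𝐒𝐞𝐭 ℓ} where
    private
      module X = Setoid X
      module Y = Setoid Y

    -- Injectivity is required only on `P`, so that limit projections and transition maps, which
    -- need not be injective as a whole, are covered too.
    F₁-injectiveOn : (g : X ⟶ₛ Y) (P : ∣ X ∣ → Set ℓ) →
                     (∀ {x y} → P x → P y → (g ⟨$⟩ x) Y.≈ (g ⟨$⟩ y) → x X.≈ y) →
                     {t s : Term ∣ X ∣} → (∀ {x} → x ∈fv t → P x) → (∀ {x} → x ∈fv s → P x) →
                     Y ⊢ F₁ g ⟨$⟩ t ∼ F₁ g ⟨$⟩ s → X ⊢ t ∼ s
    F₁-injectiveOn g P inj {t} {s} Pt Ps gt∼gs =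
      ∼-trans (∼-sym (retracts t Pt)) (∼-trans ([]-congˡ retraction gt∼gs) (retracts s Ps))
      where
      Preimage : ∣ Y ∣ → Set ℓ
      Preimage y = ∃[ x ] (P x × (g ⟨$⟩ x) Y.≈ y)

      r : (y : ∣ Y ∣) → Dec (Preimage y) → Term ∣ X ∣
      r y (yes (x , _)) = var x
      -- The default comes from the data, as a term over a given `X` need not exist in general.
      r y (no _)        = t

      -- Equal points are decided separately and may receive different preimages; injectivity on `P`
      -- identifies these.
      r-cong : ∀ {y y′} d d′ → y Y.≈ y′ → X ⊢ r y d ∼ r y′ d′
      r-cong (yes (x , Px , gx≈y)) (yes (x′ , Px′ , gx′≈y′)) y≈y′ =
        ≈-var (inj Px Px′ (Y.trans gx≈y (Y.trans y≈y′ (Y.sym gx′≈y′))))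
      r-cong (yes (x , Px , gx≈y)) (no none) y≈y′ =
        ⊥-elim (none (x , Px , Y.trans gx≈y y≈y′))
      r-cong (no none) (yes (x , Px , gx≈y′)) y≈y′ =
        ⊥-elim (none (x , Px , Y.trans gx≈y′ (Y.sym y≈y′)))
      r-cong (no _) (no _) _ = ∼-refl

      retraction : Y ⟶ₛ T X
      retraction = record { to = λ y → r y em ; cong = r-cong em em }

      r-image : ∀ {x} → P x → (d : Dec (Preimage (g ⟨$⟩ x))) → X ⊢ r (g ⟨$⟩ x) d ∼ var x
      r-image Px (yes (x′ , Px′ , gx′≈gx)) = ≈-var (inj Px′ Px gx′≈gx)
      r-image Px (no none)                 = ⊥-elim (none (_ , Px , Y.refl))

      retracts : ∀ u → (∀ {x} → x ∈fv u → P x) → X ⊢ (F₁ g ⟨$⟩ u) [ retraction ⟨$⟩_ ] ∼ u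
      retracts u Pu = ∼-trans ([]-assoc X u (λ x → var (g ⟨$⟩ x)) (retraction ⟨$⟩_))
        (∼-trans ([]-cong-fv X u (λ x∈ → r-image (Pu x∈) em)) ([]-identity X u))

    F₁-injective : (m : X ⟶ₛ Y) → Injective X._≈_ Y._≈_ (m ⟨$⟩_) →
                   Injective (X ⊢_∼_) (Y ⊢_∼_) (F₁ m ⟨$⟩_)
    F₁-injective m inj = F₁-injectiveOn m (λ _ → ⊤) (λ _ _ → inj) (λ _ → tt) (λ _ → tt)

    -- Each occurrence of a variable gets its own preimage, so no setoid map from `Y` back to `X`
    -- has to be chosen.
    F₁-lift : (g : X ⟶ₛ Y) (Q : ∣ X ∣ → Set ℓ) (t : Term ∣ Y ∣) →
              (∀ {y} → y ∈fv t → ∃[ x ] ((g ⟨$⟩ x) Y.≈ y × Q x)) →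
              ∃[ s ] ((Y ⊢ F₁ g ⟨$⟩ s ∼ t) × (∀ {x} → x ∈fv s → Q x))
    F₁-lift g Q (var y) pre =
      let (x , gx≈y , Qx) = pre here in var x , ≈-var gx≈y , λ { here → Qx }
    F₁-lift g Q (op o ts) pre =
      op o (λ i → proj₁ (lifts i)) , op-cong (λ i → proj₁ (proj₂ (lifts i))) ,
      λ { (there i x∈) → proj₂ (proj₂ (lifts i)) x∈ }
      where
      lifts : ∀ i → _
      lifts i = F₁-lift g Q (ts i) (pre ∘ there i)

  preservesMonos : PreservesMonos (Monad.functor (generatedMonad 𝕋))
  preservesMonos m mono = injective⇒mono (F₁ m) (F₁-injective m (mono⇒injective m mono))

  infix 4 _∋_∈≈_

  -- Occurrence up to equality in `X`: `≈-var` exchanges equal variables, so plain `∈fv` is not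
  -- invariant under `∼`.
  _∋_∈≈_ : (X : 𝐒𝐞𝐭 ℓ) → ∣ X ∣ → Term ∣ X ∣ → Set ℓ
  X ∋ x ∈≈ t = ∃[ y ] (y ∈fv t × Setoid._≈_ X y x)

  module NoDrop (noDrop : NoDropEquations 𝕋) where

    -- `IsDrop` is a negation, so `noDrop` gives only a double negation; excluded middle removes it.
    axiom-fv : ∀ a x → (x ∈fv Eqn.lhs a) ⇔ (x ∈fv Eqn.rhs a)
    axiom-fv a with em {∀ x → (x ∈fv Eqn.lhs a) ⇔ (x ∈fv Eqn.rhs a)}
    ... | yes eq  = eq
    ... | no drop = ⊥-elim (noDrop a drop)

    module _ {X : 𝐒𝐞𝐭 ℓ} where
      open Setoid X renaming (refl to ≈-refl; sym to ≈-sym; trans to ≈-trans)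

      private
        _⊑_ : Rel (Term ∣ X ∣) ℓ
        t ⊑ s = ∀ {x} → x ∈fv t → X ∋ x ∈≈ s

      -- Both inclusions are proved together because `∼-sym` swaps them. For an axiom, a variable of
      -- one side's instance lies in some `σ x` with `x` on that side, hence also on the other.
      ∼⇒⊑⊒ : ∀ {t s} → X ⊢ t ∼ s → t ⊑ s × s ⊑ t
      ∼⇒⊑⊒ (≈-var x≈y) = (λ { here → _ , here , ≈-sym x≈y }) , (λ { here → _ , here , x≈y })
      ∼⇒⊑⊒ (axiom a σ) =
        (λ y∈ → let (x , x∈ , y∈σx) = ∈fv-[]⁻ (Eqn.lhs a) y∈
                in _ , ∈fv-[]⁺ (Equivalence.to (axiom-fv a x) x∈) y∈σx , ≈-refl) ,
        (λ y∈ → let (x , x∈ , y∈σx) = ∈fv-[]⁻ (Eqn.rhs a) y∈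
                in _ , ∈fv-[]⁺ (Equivalence.from (axiom-fv a x) x∈) y∈σx , ≈-refl)
      ∼⇒⊑⊒ (op-cong eqs) =
        (λ { (there i x∈) → let (y , y∈ , eq) = proj₁ (∼⇒⊑⊒ (eqs i)) x∈ in y , there i y∈ , eq }) ,
        (λ { (there i x∈) → let (y , y∈ , eq) = proj₂ (∼⇒⊑⊒ (eqs i)) x∈ in y , there i y∈ , eq })
      ∼⇒⊑⊒ ∼-refl = (λ x∈ → _ , x∈ , ≈-refl) , (λ x∈ → _ , x∈ , ≈-refl)
      ∼⇒⊑⊒ (∼-sym t∼s) = proj₂ (∼⇒⊑⊒ t∼s) , proj₁ (∼⇒⊑⊒ t∼s)
      ∼⇒⊑⊒ (∼-trans t∼s s∼r) =
        ⊑-trans (proj₁ (∼⇒⊑⊒ t∼s)) (proj₁ (∼⇒⊑⊒ s∼r)) ,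
        ⊑-trans (proj₂ (∼⇒⊑⊒ s∼r)) (proj₂ (∼⇒⊑⊒ t∼s))
        where
        ⊑-trans : ∀ {t s r} → t ⊑ s → s ⊑ r → t ⊑ r
        ⊑-trans t⊑s s⊑r x∈ =
          let (y , y∈ , y≈x) = t⊑s x∈
              (z , z∈ , z≈y) = s⊑r y∈
          in z , z∈ , ≈-trans z≈y y≈x

    module _ {X Y : 𝐒𝐞𝐭 ℓ} (g : X ⟶ₛ Y) {t : Term ∣ X ∣} {s : Term ∣ Y ∣}
             (gt∼s : Y ⊢ F₁ g ⟨$⟩ t ∼ s) where
      private
        module Y = Setoid Y

      -- The variables of `F₁ g ⟨$⟩ t` are the images of those of `t`, and invariance carries them
      -- to `s`. With `∈≈-preimage`, `g` maps one variable set onto the other.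
      ∈≈-image : ∀ {x} → X ∋ x ∈≈ t → Y ∋ g ⟨$⟩ x ∈≈ s
      ∈≈-image (x′ , x′∈ , x′≈x) =
        let (y , y∈ , y≈gx′) = proj₁ (∼⇒⊑⊒ gt∼s) (∈fv-[]⁺ x′∈ here)
        in y , y∈ , Y.trans y≈gx′ (Func.cong g x′≈x)

      ∈≈-preimage : ∀ {y} → Y ∋ y ∈≈ s → ∃[ x ] (x ∈fv t × (g ⟨$⟩ x) Y.≈ y)
      ∈≈-preimage (y′ , y′∈ , y′≈y) with proj₂ (∼⇒⊑⊒ gt∼s) y′∈
      ... | z , z∈ , z≈y′ with ∈fv-[]⁻ t z∈
      ...   | x , x∈ , here = x , x∈ , Y.trans z≈y′ y′≈y

    -- As `F₁ p` and `F₁ m` are injective, it suffices to lift each term along `F₁ p` separately: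
    -- congruence, the second triangle and uniqueness follow by cancellation.
    preservesPullbacks : PreservesPullbacksOfMonos (Monad.functor (generatedMonad 𝕋))
    preservesPullbacks {P} {X} {Z} {Y} p q f m mono pb = record
      { commutes  = square
      ; universal = λ W a b fa≗mb →
          let u   = λ w → lifted (a ⟨$⟩ w) (b ⟨$⟩ w) (fa≗mb w)
              pu∼ = λ w → proj₁ (proj₂ (u w))
          in record { to   = λ w → proj₁ (u w)
                    ; cong = λ {w} {w′} w≈w′ → Fp-injective
                        (∼-trans (pu∼ w) (∼-trans (Func.cong a w≈w′) (∼-sym (pu∼ w′)))) }
             , pu∼
             , (λ w → Fm-injective (∼-trans (∼-sym (square (proj₁ (u w))))
                        (∼-trans (Func.cong (F₁ f) (pu∼ w)) (fa≗mb w))))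
             , (λ v pv≗a _ w → Fp-injective (∼-trans (pv≗a w) (∼-sym (pu∼ w))))
      }
      where
      Fm-injective : Injective (Z ⊢_∼_) (Y ⊢_∼_) (F₁ m ⟨$⟩_)
      Fm-injective = F₁-injective m (mono⇒injective m mono)

      Fp-injective : Injective (P ⊢_∼_) (X ⊢_∼_) (F₁ p ⟨$⟩_)
      Fp-injective = F₁-injective p (pullback-injective pb mono)

      square : F₁ f ∘ₛ F₁ p ≗ F₁ m ∘ₛ F₁ q
      square t = ∼-trans (∼-sym (F-∘ f p t))
        (∼-trans (F-cong (f ∘ₛ p) (m ∘ₛ q) (IsPullback.commutes pb) t) (F-∘ m q t))

      -- For a variable `x` of `t`, invariance makes `f ⟨$⟩ x` the image under `m` of a variable `z`
      -- of `s`, and the pair yields a point of `P`.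
      lifted : ∀ t s → Y ⊢ F₁ f ⟨$⟩ t ∼ F₁ m ⟨$⟩ s →
               ∃[ u ] ((X ⊢ F₁ p ⟨$⟩ u ∼ t) × (∀ {x} → x ∈fv u → ⊤))
      lifted t s ft∼ms = F₁-lift p (λ _ → ⊤) t λ {x} x∈ →
        let (z , _ , mz≈fx) = ∈≈-preimage m {s} (∼-sym ft∼ms) (_ , ∈fv-[]⁺ x∈ here , Setoid.refl Y)
            (u , pu≈x) = pullback-point pb x z (Setoid.sym Y mz≈fx)
        in u , pu≈x , tt

-- Upper bounds in regular ordinals

ω : Ordinal ℓ
ω {ℓ} = record
  { order = record
    { Carrier = Lift ℓ ℕ
    ; _≈_     = λ m n → Lift ℓ (lower m ≡ lower n)
    ; _<_     = λ m n → Lift ℓ (lower m ℕ.< lower n)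
    ; isStrictTotalOrder = record
      { isStrictPartialOrder = record
        { isEquivalence = record
          { refl  = lift refl
          ; sym   = λ p → lift (sym (lower p))
          ; trans = λ p q → lift (trans (lower p) (lower q))
          }
        ; irrefl   = λ p q → ℕ.<-irrefl (lower p) (lower q)
        ; trans    = λ p q → lift (ℕ.<-trans (lower p) (lower q))
        ; <-resp-≈ = (λ { (lift refl) p → p }) , (λ { (lift refl) p → p })
        }
      ; compare = compare
      }
    }
  ; wellFounded = Subrelation.wellFounded lower (On.wellFounded lower <-wellFounded)
  }
  where
  compare : (m n : Lift ℓ ℕ) → _
  compare m n with ℕ.<-cmp (lower m) (lower n)
  ... | tri< a ¬b ¬c = tri< (lift a) (¬b ∘ lower) (¬c ∘ lower)
  ... | tri≈ ¬a b ¬c = tri≈ (¬a ∘ lower) (lift b) (¬c ∘ lower)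
  ... | tri> ¬a ¬b c = tri> (¬a ∘ lower) (¬b ∘ lower) (lift c)

module RegularOrdinal (em : ExcludedMiddle ℓ) (ρ : Ordinal ℓ)
                      (uncountable : IsUncountable ρ) (regular : IsRegular ρ) where
  open Ordinal ρ
  open StrictTotalOrder order using (compare) renaming (trans to <-trans; <-respˡ-≈ to <-respˡ)
  open IsLimitOrdinal (proj₁ regular)

  origin : ∣ underlying ∣
  origin = nonZero

  upperBound : ∀ α β → ∃[ γ ] (α < γ × β < γ)
  upperBound α β with compare α β
  ... | tri< α<β _ _ = let (γ , β<γ) = notSuccessor β in γ , <-trans α<β β<γ , β<γ
  ... | tri≈ _ α≈β _ = let (γ , β<γ) = notSuccessor β in γ , <-respˡ (Eq.sym α≈β) β<γ , β<γ
  ... | tri> _ _ β<α = let (γ , α<γ) = notSuccessor α in γ , α<γ , <-trans β<α α<γ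

  -- Regularity makes `ρ` the least type of a cofinal subset, so it would embed into `ω` and be
  -- countable.
  ω-notCofinal : ¬ CofinalSubsetOfType ρ ω
  ω-notCofinal cof = uncountable record
    { to        = λ α → lower (embed ⟨$⟩ α)
    ; cong      = λ α≈β → lower (Func.cong embed α≈β)
    ; injective = injective
    }
    where
    open _≼_ (IsCofinalityOf.least (proj₂ regular) ω cof)

    injective : ∀ {α β} → lower (embed ⟨$⟩ α) ≡ lower (embed ⟨$⟩ β) → α ≈ β
    injective {α} {β} eq with compare α β
    ... | tri< α<β _ _ = ⊥-elim (ℕ.<-irrefl eq (lower (increasing α<β)))
    ... | tri≈ _ α≈β _ = α≈β
    ... | tri> _ _ β<α = ⊥-elim (ℕ.<-irrefl (sym eq) (lower (increasing β<α)))

  module _ (a : ℕ → ∣ underlying ∣) (step : ∀ n → a n < a (ℕ.suc n)) where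

    increasing : ∀ {m n} → m ℕ.<′ n → a m < a n
    increasing ℕ.<′-base        = step _
    increasing (ℕ.<′-step m<n) = <-trans (increasing m<n) (step _)

    -- An unbounded sequence would itself enumerate a cofinal subset of type `ω`.
    sequence-bounded : ∃[ γ ] (∀ n → a n < γ)
    sequence-bounded with em {∃[ γ ] (∀ n → a n < γ)}
    ... | yes bounded  = bounded
    ... | no unbounded = ⊥-elim (ω-notCofinal record
      { enum       = record { to   = λ n → a (lower n)
                            ; cong = λ { (lift refl) → Eq.refl } }
      ; increasing = λ m<n → increasing (ℕ.<⇒<′ (lower m<n))
      ; cofinal    = cofinal
      })
      where
      cofinal : ∀ α → ∃[ n ] (α ≤ a (lower n))
      cofinal α with em {∃[ n ] (α ≤ a (lower n))}
      ... | yes found = found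
      ... | no none   = ⊥-elim (unbounded (α , below))
        where
        below : ∀ n → a n < α
        below n with compare (a n) α
        ... | tri< an<α _ _ = an<α
        ... | tri≈ _ an≈α _ = ⊥-elim (none (lift n , inj₂ (Eq.sym an≈α)))
        ... | tri> _ _ α<an = ⊥-elim (none (lift n , inj₁ α<an))

-- Limits along regular ordinals

module Limits (em : ExcludedMiddle ℓ) (𝕋 : Theory ℓ) (noDrop : NoDropEquations 𝕋)
              (ρ : Ordinal ℓ) (uncountable : IsUncountable ρ) (regular : IsRegular ρ)
              (X : Diagram ρ) where
  open Theory 𝕋
  open Generated 𝕋
  open TheoryFunctor em 𝕋
  open NoDrop noDrop
  open Ordinal ρ
  open RegularOrdinal em ρ uncountable regular
  open Diagram X
  private
    module X (α : ∣ underlying ∣) = Setoid (X₀ α)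
    functor = Monad.functor (generatedMonad 𝕋)

  -- The composite inequality is an arbitrary `r`: proofs of `≤` are not unique, but `X-cong`
  -- identifies their maps.
  X₁-∘ : ∀ {α β γ} (p : α ≤ β) (q : β ≤ γ) (r : α ≤ γ) x →
         X._≈_ α (X₁ p ⟨$⟩ (X₁ q ⟨$⟩ x)) (X₁ r ⟨$⟩ x)
  X₁-∘ {α} p q r x = X.trans α (X.sym α (X-∘ p q x)) (X-cong (≤-trans p q) r x)

  -- Distinct threads differ at some index. Finitely many variables are thus separated at a single
  -- `ε`, where `π X ε` is injective on them.
  canonical-injective : Injective (lim X ⊢_∼_) (Setoid._≈_ (lim (functor ∘ᴰ X)))
                                  (canonical functor X ⟨$⟩_)
  canonical-injective {t} {s} eq =
    let (α , tt≈) = separate t t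
        (β , ts≈) = separate t s
        (γ , ss≈) = separate s s
        (δ , α<δ , β<δ) = upperBound α β
        (ε , δ<ε , γ<ε) = upperBound δ γ
        α≤ε = ≤-trans (inj₁ α<δ) (inj₁ δ<ε)
        β≤ε = ≤-trans (inj₁ β<δ) (inj₁ δ<ε)
    in F₁-injectiveOn (π X ε) (λ x → x ∈fv t ⊎ x ∈fv s)
         (λ { {x} {y} (inj₁ x∈) (inj₁ y∈) e → tt≈ x∈ y∈ (descend α≤ε x y e)
            ; {x} {y} (inj₁ x∈) (inj₂ y∈) e → ts≈ x∈ y∈ (descend β≤ε x y e)
            ; {x} {y} (inj₂ x∈) (inj₁ y∈) e → Setoid.sym (lim X) {y} {x}
                (ts≈ y∈ x∈ (descend β≤ε y x (X.sym ε e)))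
            ; {x} {y} (inj₂ x∈) (inj₂ y∈) e → ss≈ x∈ y∈ (descend (inj₁ γ<ε) x y e) })
         inj₁ inj₂ (eq ε)
    where
    K : ∣ underlying ∣ → Rel ∣ lim X ∣ ℓ
    K α x y = X._≈_ α (proj₁ x α) (proj₁ y α)

    descend : ∀ {α β} → α ≤ β → ∀ x y → K β x y → K α x y
    descend {α} α≤β x y e =
      X.trans α (X.sym α (proj₂ x α≤β)) (X.trans α (Func.cong (X₁ α≤β) e) (proj₂ y α≤β))

    separate : (t s : Term ∣ lim X ∣) →
               ∃[ α ] (∀ {x y} → x ∈fv t → y ∈fv s → K α x y → ∀ β → K β x y)
    separate = fv-kernels-stabilise upperBound origin em K
                 (λ α<β {x} {y} → descend (inj₁ α<β) x y)

  -- Surjectivity of the canonical map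

  module _ (t : (α : ∣ underlying ∣) → Term ∣ X₀ α ∣) (compatible : Compatible (functor ∘ᴰ X) t) where

    S : (α : ∣ underlying ∣) → ∣ X₀ α ∣ → Set ℓ
    S α x = X₀ α ∋ x ∈≈ t α

    ∈fv⇒S : ∀ {α x} → x ∈fv t α → S α x
    ∈fv⇒S {α} x∈ = _ , x∈ , X.refl α

    S-restrict : ∀ {α β} (p : α ≤ β) {x} → S β x → S α (X₁ p ⟨$⟩ x)
    S-restrict p = ∈≈-image (X₁ p) (compatible p)

    S-extend : ∀ {α β} (p : α ≤ β) {x} → S α x →
               ∃[ y ] (y ∈fv t β × X._≈_ α (X₁ p ⟨$⟩ y) x)
    S-extend p = ∈≈-preimage (X₁ p) (compatible p)

    Collapsed : ∀ {α β} → α < β → Rel ∣ X₀ β ∣ ℓ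
    Collapsed {α} {β} p x y =
      S β x × S β y × X._≈_ α (X₁ (inj₁ p) ⟨$⟩ x) (X₁ (inj₁ p) ⟨$⟩ y) × ¬ X._≈_ β x y

    -- Injectivity of all later restrictions, phrased so that its failure yields the collapsed pair
    -- used in `next`.
    Stable : ∣ underlying ∣ → Set ℓ
    Stable α = ∀ {β} (p : α < β) {x y} → ¬ Collapsed p x y

    no-collapsing-sequence :
      (a : ℕ → ∣ underlying ∣) (step : ∀ n → a n < a (ℕ.suc n)) →
      ¬ (∀ n → ∃[ x ] ∃[ y ] Collapsed (step n) x y)
    no-collapsing-sequence a step collapse =
      let (γ , a<γ) = sequence-bounded a step
          X↓ = λ n → X₁ (inj₁ (a<γ n))
          K  = λ m x y → X._≈_ (a (lower m)) (X↓ (lower m) ⟨$⟩ x) (X↓ (lower m) ⟨$⟩ y)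
          (lift n , stable) =
            fv-kernels-stabilise {I = Lift ℓ ℕ} {_≲_ = λ m n → a (lower m) ≤ a (lower n)}
              directed (lift 0) em K
              (λ {m} {n} m≤n {x} {y} e → X.trans (a (lower m))
                (X.sym (a (lower m)) (X₁-∘ m≤n (inj₁ (a<γ (lower n))) (inj₁ (a<γ (lower m))) x))
                (X.trans (a (lower m)) (Func.cong (X₁ m≤n) e)
                  (X₁-∘ m≤n (inj₁ (a<γ (lower n))) (inj₁ (a<γ (lower m))) y)))
              (t γ) (t γ)
          -- The pair collapsed at step `n` lifts to variables of `t γ`. These agree at stage `n`,
          -- hence by stability at the next one, where `u` and `v` differ.
          (u , v , Su , Sv , u≈v , u≉v) = collapse n
          (x , x∈ , x↦u) = S-extend (inj₁ (a<γ (ℕ.suc n))) Su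
          (y , y∈ , y↦v) = S-extend (inj₁ (a<γ (ℕ.suc n))) Sv
          ↦ = λ {z} {w} (z↦w : X._≈_ (a (ℕ.suc n)) (X↓ (ℕ.suc n) ⟨$⟩ z) w) →
                X.trans (a n)
                  (X.sym (a n) (X₁-∘ (inj₁ (step n)) (inj₁ (a<γ (ℕ.suc n))) (inj₁ (a<γ n)) z))
                  (Func.cong (X₁ (inj₁ (step n))) z↦w)
          x≈y = stable x∈ y∈ (X.trans (a n) (↦ x↦u) (X.trans (a n) u≈v (X.sym (a n) (↦ y↦v))))
                  (lift (ℕ.suc n))
      in u≉v (X.trans (a (ℕ.suc n)) (X.sym (a (ℕ.suc n)) x↦u) (X.trans (a (ℕ.suc n)) x≈y y↦v))
      where
      directed : (m n : Lift ℓ ℕ) → ∃[ k ] (a (lower m) ≤ a (lower k) × a (lower n) ≤ a (lower k))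
      directed (lift m) (lift n) = lift (m ℕ.⊔ n) , mono (ℕ.m≤m⊔n m n) , mono (ℕ.m≤n⊔m m n)
        where
        mono : ∀ {m n} → m ℕ.≤ n → a m ≤ a n
        mono m≤n with ℕ.m≤n⇒m<n∨m≡n m≤n
        ... | inj₁ m<n  = inj₁ (increasing a step (ℕ.<⇒<′ m<n))
        ... | inj₂ refl = ≤-refl

    stabilises : ∃[ α ] Stable α
    stabilises with em {∃[ α ] Stable α}
    ... | yes stable   = stable
    ... | no  unstable = ⊥-elim (no-collapsing-sequence a
                           (λ n → proj₁ (proj₂ (next (a n)))) (λ n → proj₂ (proj₂ (next (a n)))))
      where
      next : ∀ α → Σ[ β ∈ ∣ underlying ∣ ] Σ[ p ∈ α < β ] ∃[ x ] ∃[ y ] Collapsed p x y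
      next α with em {Σ[ β ∈ ∣ underlying ∣ ] Σ[ p ∈ α < β ] ∃[ x ] ∃[ y ] Collapsed p x y}
      ... | yes found = found
      ... | no none   = ⊥-elim (unstable (α , λ p c → none (_ , p , _ , _ , c)))

      a : ℕ → ∣ underlying ∣
      a ℕ.zero    = origin
      a (ℕ.suc n) = proj₁ (next (a n))

    private
      α₀ : ∣ underlying ∣
      α₀ = proj₁ stabilises

    S-injective : ∀ {β} (p : α₀ < β) {x y} → S β x → S β y →
                  X._≈_ α₀ (X₁ (inj₁ p) ⟨$⟩ x) (X₁ (inj₁ p) ⟨$⟩ y) → X._≈_ β x y
    S-injective {β} p {x} {y} Sx Sy e with em {X._≈_ β x y}
    ... | yes x≈y = x≈y
    ... | no  x≉y = ⊥-elim (proj₂ stabilises p (Sx , Sy , e , x≉y))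

    private
      -- Stability concerns indices strictly above `α₀`, so components at `α` are computed at
      -- `bound α` and restricted.
      bound : ∣ underlying ∣ → ∣ underlying ∣
      bound α = proj₁ (upperBound α₀ α)

      α₀<bound : ∀ α → α₀ < bound α
      α₀<bound α = proj₁ (proj₂ (upperBound α₀ α))

      ≤bound : ∀ α → α ≤ bound α
      ≤bound α = inj₁ (proj₂ (proj₂ (upperBound α₀ α)))

    -- Staying inside the variable sets is what lets `S-injective` apply to the term built from
    -- threads.
    Thread : ∣ lim X ∣ → Set ℓ
    Thread x = ∀ α → S α (proj₁ x α)

    -- Above `α₀` the restrictions of variable sets are bijective, so `x` has an essentially unique
    -- lift to each later stage.
    thread : ∀ {x} → x ∈fv t α₀ → ∃[ y ] (X._≈_ α₀ (proj₁ y α₀) x × Thread y)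
    thread {x} x∈ =
      (y , λ {α} {β} α≤β → X.trans α
             (X₁-∘ α≤β (≤bound β) (≤-trans α≤β (≤bound β)) (z β))
             (X.sym α (y-independent α β (≤-trans α≤β (≤bound β)))))
      , X.trans α₀ (X-cong (≤bound α₀) (inj₁ (α₀<bound α₀)) (z α₀)) (z↦x α₀)
      , λ α → S-restrict (≤bound α) (∈fv⇒S (z∈ α))
      where
      z-data : ∀ α → _
      z-data α = S-extend (inj₁ (α₀<bound α)) (∈fv⇒S x∈)

      z : ∀ α → ∣ X₀ (bound α) ∣
      z α = proj₁ (z-data α)

      z∈ : ∀ α → z α ∈fv t (bound α)
      z∈ α = proj₁ (proj₂ (z-data α))

      z↦x : ∀ α → X._≈_ α₀ (X₁ (inj₁ (α₀<bound α)) ⟨$⟩ z α) x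
      z↦x α = proj₂ (proj₂ (z-data α))

      y : ∀ α → ∣ X₀ α ∣
      y α = X₁ (≤bound α) ⟨$⟩ z α

      -- Both lifts of `x` extend to variables `w`, `w′` at a common later `ζ`. These lie over `x`,
      -- so `S-injective` identifies them, and so their restrictions to `α`.
      y-independent : ∀ α β (α≤ : α ≤ bound β) → X._≈_ α (y α) (X₁ α≤ ⟨$⟩ z β)
      y-independent α β α≤ =
        let (ζ , α<ζ , β<ζ) = upperBound (bound α) (bound β)
            (w , w∈ , w↦z) = S-extend (inj₁ α<ζ) (∈fv⇒S (z∈ α))
            (w′ , w′∈ , w′↦z) = S-extend (inj₁ β<ζ) (∈fv⇒S (z∈ β))
            α₀<ζ = StrictTotalOrder.trans order (α₀<bound α) α<ζ
            w≈w′ = S-injective α₀<ζ (∈fv⇒S w∈) (∈fv⇒S w′∈)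
                     (X.trans α₀ (over (α₀<bound α) α<ζ α₀<ζ w↦z (z↦x α))
                       (X.sym α₀ (over (α₀<bound β) β<ζ α₀<ζ w′↦z (z↦x β))))
            α≤ζ = ≤-trans α≤ (inj₁ β<ζ)
        in X.trans α (X.sym α (Func.cong (X₁ (≤bound α)) w↦z))
          (X.trans α (X₁-∘ (≤bound α) (inj₁ α<ζ) α≤ζ w)
          (X.trans α (Func.cong (X₁ α≤ζ) w≈w′)
          (X.trans α (X.sym α (X₁-∘ α≤ (inj₁ β<ζ) α≤ζ w′))
            (Func.cong (X₁ α≤) w′↦z))))
        where
        over : ∀ {β ζ} (p : α₀ < β) (q : β < ζ) (r : α₀ < ζ) {v w} →
               X._≈_ β (X₁ (inj₁ q) ⟨$⟩ w) v → X._≈_ α₀ (X₁ (inj₁ p) ⟨$⟩ v) x →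
               X._≈_ α₀ (X₁ (inj₁ r) ⟨$⟩ w) x
        over p q r w↦v v↦x = X.trans α₀ (X.sym α₀ (X₁-∘ (inj₁ p) (inj₁ q) (inj₁ r) _))
          (X.trans α₀ (Func.cong (X₁ (inj₁ p)) w↦v) v↦x)

    -- Lifting `t α₀` along threads gives `s`. At `bound α` the projection of `s` and `t` have the
    -- same restriction to `α₀`; injectivity on `S` makes them equal there, and restriction carries
    -- this to `α`.
    limit-preimage : ∃[ s ] (∀ α → X₀ α ⊢ F₁ (π X α) ⟨$⟩ s ∼ t α)
    limit-preimage =
      let (s , πs∼t , threads) = F₁-lift (π X α₀) Thread (t α₀) thread
          restrict = proj₂ (canonical functor X ⟨$⟩ s)
          late = λ α → F₁-injectiveOn (X₁ (inj₁ (α₀<bound α))) (S (bound α))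
                   (S-injective (α₀<bound α))
                   (π-vars-S s threads)
                   ∈fv⇒S
                   (∼-trans (restrict (inj₁ (α₀<bound α)))
                     (∼-trans πs∼t (∼-sym (compatible (inj₁ (α₀<bound α))))))
      in s , λ α → ∼-trans (∼-sym (restrict (≤bound α)))
                     (∼-trans (Func.cong (F₁ (X₁ (≤bound α))) (late α)) (compatible (≤bound α)))
      where
      π-vars-S : ∀ s → (∀ {y} → y ∈fv s → Thread y) →
               ∀ {α x} → x ∈fv (F₁ (π X α) ⟨$⟩ s) → S α x
      π-vars-S s threads x∈ with ∈fv-[]⁻ s x∈
      ... | y , y∈ , here = threads y∈ _

  canonical-bijective : Bijective (lim X ⊢_∼_) (Setoid._≈_ (lim (functor ∘ᴰ X)))
                                  (canonical functor X ⟨$⟩_)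
  canonical-bijective =
    (λ {t} {s} → canonical-injective {t} {s}) , λ { (t , compatible) →
    let (s , πs∼t) = limit-preimage t compatible
    in s , λ r∼s α → ∼-trans (Func.cong (F₁ (π X α)) r∼s) (πs∼t α) }

mainTheorem2 : {ℓ : Level} → ExcludedMiddle ℓ →
    (𝕋 : Theory ℓ) → NoDropEquations 𝕋 →
    let T = Monad.functor (generatedMonad 𝕋) in
    PreservesPullbacksOfMonos T
    × PreservesMonos T
    × ((ρ : Ordinal ℓ) → IsUncountable ρ → IsRegular ρ → PreservesOpLimits T ρ)
mainTheorem2 em 𝕋 noDrop =
  NoDrop.preservesPullbacks noDrop ,
  preservesMonos ,
  Limits.canonical-bijective em 𝕋 noDrop
  where
  open TheoryFunctor em 𝕋
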